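{- For all $n\geq 1$, \[2\bar{a}_2(n)=\bar{p}(2n,n).\]
   Context: An overpartition of $n$ is a partition of $n$ in which the first occurrence of each distinct part value may be overlined. $\bar{a}_2(n)$ is the number of overpartitions of $n$ in which the smallest part value occurs at least twice, where an overlined part and a non-overlined part of the same value count as equal. $\bar{p}(N,t)$ is the number of overpartitions of $N$ in which the largest part minus the smallest part equals $t$. -}

module Defs where

open import Data.Bool using (Bool; true; false)
import Data.Bool.Properties as Bool
open import Data.Empty using (⊥)
open import Data.List using (List; []; _∷_; _++_; length; map; filter; concatMap)
open import Data.List.Extrema.Nat using (min; max)
open import Data.List.Membership.Propositional using (_∈_)
open import Data.List.Membership.Propositional.Properties
  using (∈-filter⁺; ∈-filter⁻; ∈-concatMap⁺; ∈-++⁻)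
open import Data.List.Relation.Unary.All as All using (All; []; _∷_)
open import Data.List.Relation.Unary.AllPairs as AllPairs using (AllPairs; []; _∷_)
open import Data.List.Relation.Unary.Any using (here; there)
import Data.List.Relation.Unary.Any as Any
open import Data.List.Relation.Unary.Linked using (Linked; linked?)
open import Data.List.Relation.Unary.Unique.Propositional using (Unique)
import Data.List.Relation.Unary.Unique.Propositional.Properties as Unique
open import Data.Nat using (ℕ; zero; suc; _+_; _≤_; _≥_; _≟_; _≤?_; s≤s; z≤n)
open import Data.Nat.ListAction using (sum)
import Data.Nat.Properties as ℕ
open import Data.Product using (_,_; proj₂)
open import Data.Sum using (inj₁; inj₂)
open import Function using (_∘_; _⇔_; mk⇔)
open import Relation.Binary.PropositionalEquality
  using (_≡_; refl; sym; subst)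
open import Relation.Nullary using (no)
open import Relation.Nullary.Decidable using (map′; _×-dec_; _→-dec_)
open import Relation.Unary using (Decidable)

record Part : Set where
  constructor part
  field
    size      : ℕ
    overlined : Bool

open Part public

sizes : List Part → List ℕ
sizes = map size

-- The parts are listed in weakly decreasing order, so every overpartition is
-- represented by exactly one list.
record IsOverpartition (n : ℕ) (xs : List Part) : Set where
  constructor isOverpartition
  field
    total      : sum (sizes xs) ≡ n
    positive   : All (λ x → 1 ≤ size x) xs
    decreasing : Linked (λ x y → size x ≥ size y) xs
    -- y, preceded by a part x of the same size, is not a first occurrence.
    marking    : AllPairs (λ x y → size x ≡ size y → overlined y ≡ false) xs

open IsOverpartition public

isOverpartition? : ∀ n → Decidable (IsOverpartition n)
isOverpartition? n xs =
  map′ (λ (a , b , c , d) → isOverpartition a b c d)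
       (λ p → total p , positive p , decreasing p , marking p)
       ((sum (sizes xs) ≟ n)
         ×-dec All.all? (λ x → 1 ≤? size x) xs
         ×-dec linked? (λ x y → size y ≤? size x) xs
         ×-dec AllPairs.allPairs?
                 (λ x y → (size x ≟ size y) →-dec (overlined y Bool.≟ false)) xs)

-- All lists of positive parts, in any order and with arbitrary overlining, of
-- total n: such a list of total suc n arises from exactly one of total n by
-- prepending a part 1 or by enlarging the first part by one.
bumpHead : List Part → List (List Part)
bumpHead []       = []
bumpHead (x ∷ xs) = (part (suc (size x)) (overlined x) ∷ xs) ∷ []

extend : List Part → List (List Part)
extend xs = (part 1 false ∷ xs) ∷ (part 1 true ∷ xs) ∷ bumpHead xs

compositions : ℕ → List (List Part)
compositions zero    = [] ∷ []
compositions (suc n) = concatMap extend (compositions n)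

-- Every overpartition of n, each exactly once: see ∈-overpartitions and
-- overpartitions-unique below.
overpartitions : ℕ → List (List Part)
overpartitions n = filter (isOverpartition? n) (compositions n)

occurrences : ℕ → List ℕ → ℕ
occurrences k ks = length (filter (_≟ k) ks)

-- min k ks and max k ks are the extrema of the nonempty list k ∷ ks.
SmallestRepeats : List ℕ → Set
SmallestRepeats []       = ⊥
SmallestRepeats (k ∷ ks) = 2 ≤ occurrences (min k ks) (k ∷ ks)

smallestRepeats? : Decidable SmallestRepeats
smallestRepeats? []       = no λ ()
smallestRepeats? (k ∷ ks) = 2 ≤? occurrences (min k ks) (k ∷ ks)

-- Largest minus smallest equals t, written without truncated subtraction.
HasSpread : ℕ → List ℕ → Set
HasSpread t []       = ⊥
HasSpread t (k ∷ ks) = max k ks ≡ min k ks + t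

hasSpread? : ∀ t → Decidable (HasSpread t)
hasSpread? t []       = no λ ()
hasSpread? t (k ∷ ks) = max k ks ≟ min k ks + t

a̅₂ : ℕ → ℕ
a̅₂ n = length (filter (smallestRepeats? ∘ sizes) (overpartitions n))

p̅ : ℕ → ℕ → ℕ
p̅ N t = length (filter (hasSpread? t ∘ sizes) (overpartitions N))

private
  Pos : List Part → Set
  Pos = All (λ x → 1 ≤ size x)

  all-concatMap : ∀ {P Q : List Part → Set} → (∀ {xs} → P xs → All Q (extend xs)) →
                  ∀ {xss} → All P xss → All Q (concatMap extend xss)
  all-concatMap f []       = []
  all-concatMap f (p ∷ ps) = f p ++ᴬ all-concatMap f ps
    where
    _++ᴬ_ : ∀ {Q : List Part → Set} {xs ys} → All Q xs → All Q ys → All Q (xs ++ ys)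
    []       ++ᴬ qs = qs
    (p ∷ ps) ++ᴬ qs = p ∷ (ps ++ᴬ qs)

  extend-pos : ∀ {xs} → Pos xs → All Pos (extend xs)
  extend-pos []       = (s≤s z≤n ∷ []) ∷ (s≤s z≤n ∷ []) ∷ []
  extend-pos (p ∷ ps) =
    (s≤s z≤n ∷ p ∷ ps) ∷ (s≤s z≤n ∷ p ∷ ps) ∷ (s≤s z≤n ∷ ps) ∷ []

  compositions-pos : ∀ n → All Pos (compositions n)
  compositions-pos zero    = [] ∷ []
  compositions-pos (suc n) = all-concatMap extend-pos (compositions-pos n)

  ∈-concatMap-extend : ∀ {ys xs xss} → ys ∈ extend xs → xs ∈ xss →
                       ys ∈ concatMap extend xss
  ∈-concatMap-extend {ys} i j =
    ∈-concatMap⁺ extend (Any.map (λ eq → subst (λ zs → ys ∈ extend zs) eq i) j)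

  compositions-complete : ∀ n xs → sum (sizes xs) ≡ n → Pos xs → xs ∈ compositions n
  compositions-complete zero    []                          eq ps = here refl
  compositions-complete (suc n) (part 1 false ∷ xs) eq (_ ∷ ps) =
    ∈-concatMap-extend (here refl)
      (compositions-complete n xs (ℕ.suc-injective eq) ps)
  compositions-complete (suc n) (part 1 true ∷ xs) eq (_ ∷ ps) =
    ∈-concatMap-extend (there (here refl))
      (compositions-complete n xs (ℕ.suc-injective eq) ps)
  compositions-complete (suc n) (part (suc (suc k)) b ∷ xs) eq (_ ∷ ps) =
    ∈-concatMap-extend (there (there (here refl)))
      (compositions-complete n (part (suc k) b ∷ xs) (ℕ.suc-injective eq) (s≤s z≤n ∷ ps))
  compositions-complete zero    (part (suc _) _ ∷ xs) () ps
  compositions-complete n       (part zero _ ∷ xs)    eq (() ∷ ps)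

  shrink : List Part → List Part
  shrink []                         = []
  shrink (part (suc (suc k)) b ∷ xs) = part (suc k) b ∷ xs
  shrink (part _ _ ∷ xs)             = xs

  shrink-extend : ∀ {xs ys} → Pos xs → ys ∈ extend xs → shrink ys ≡ xs
  shrink-extend ps                              (here refl)                 = refl
  shrink-extend ps                              (there (here refl))         = refl
  shrink-extend {part (suc k) b ∷ xs} (_ ∷ ps)  (there (there (here refl))) = refl
  shrink-extend {part zero b ∷ xs}    (() ∷ ps) (there (there (here refl)))

  shrink-concatMap : ∀ {ys xss} → All Pos xss → ys ∈ concatMap extend xss → shrink ys ∈ xss
  shrink-concatMap {ys} {xs ∷ xss} (p ∷ ps) i with ∈-++⁻ (extend xs) i
  ... | inj₁ j = here (shrink-extend p j)
  ... | inj₂ j = there (shrink-concatMap ps j)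

  extend-unique : ∀ {xs} → Pos xs → Unique (extend xs)
  extend-unique [] = ((λ ()) ∷ []) ∷ [] ∷ []
  extend-unique (s≤s _ ∷ _) =
    ((λ ()) ∷ (λ ()) ∷ []) ∷ ((λ ()) ∷ []) ∷ [] ∷ []

  concatMap-unique : ∀ {xss} → All Pos xss → Unique xss → Unique (concatMap extend xss)
  concatMap-unique []       []       = []
  concatMap-unique {xs ∷ xss} (p ∷ ps) (u ∷ us) =
    Unique.++⁺ (extend-unique p) (concatMap-unique ps us)
      λ (i , j) → All.lookup u (shrink-concatMap ps j) (sym (shrink-extend p i))

  compositions-unique : ∀ n → Unique (compositions n)
  compositions-unique zero    = [] ∷ []
  compositions-unique (suc n) =
    concatMap-unique (compositions-pos n) (compositions-unique n)

∈-overpartitions : ∀ {n xs} → xs ∈ overpartitions n ⇔ IsOverpartition n xs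
∈-overpartitions {n} {xs} = mk⇔
  (λ i → proj₂ (∈-filter⁻ (isOverpartition? n) {xs = compositions n} i))
  (λ p → ∈-filter⁺ (isOverpartition? n)
           (compositions-complete n xs (total p) (positive p)) p)

overpartitions-unique : ∀ n → Unique (overpartitions n)
overpartitions-unique n = Unique.filter⁺ (isOverpartition? n) (compositions-unique n)

{-# OPTIONS --safe #-}

-- Let an overpartition of n have a repeated smallest part m. Its last part
-- is a non-overlined m; replace it by a new largest part m + n, overlined or
-- not. The total becomes 2n and the spread n. Conversely, in an
-- overpartition of 2n of spread n and smallest part m, the parts other than
-- the first, m + n, have total n − m, so all of them are smaller than m + n;
-- replacing the first part by an additional non-overlined m at the end
-- undoes the construction.
module Submission where

open import Defs
open import Data.Bool using (Bool; true; false)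
open import Data.List
  using (List; []; _∷_; _++_; _∷ʳ_; [_]; length; map; filter; cartesianProduct;
         initLast; _∷ʳ′_)
open import Data.List.Extrema.Nat using (min; max; min≤v⁺; v≤min⁺; max≤v⁺; ⊥≤max)
open import Data.List.Membership.Propositional using (_∈_; lose)
open import Data.List.Membership.Propositional.Properties
  using (∈-filter⁺; ∈-filter⁻; ∈-map⁺; ∈-map⁻; ∈-++⁺ʳ; ∈-length;
         ∈-cartesianProduct⁺; ∈-cartesianProduct⁻)
open import Data.List.Membership.Propositional.Properties.WithK using (unique∧set⇒bag)
open import Data.List.Properties
  using (length-map; length-++; length-filter; filter-++; map-++; map-∘; map-id-local)
open import Data.List.Relation.Binary.BagAndSetEquality using (∼bag⇒↭)
open import Data.List.Relation.Binary.Permutation.Propositional.Properties using (↭-length)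
open import Data.List.Relation.Unary.All as All using (All; []; _∷_)
import Data.List.Relation.Unary.All.Properties as All
open import Data.List.Relation.Unary.AllPairs using (AllPairs; []; _∷_)
import Data.List.Relation.Unary.AllPairs.Properties as AllPairs
open import Data.List.Relation.Unary.Any using (here; there)
open import Data.List.Relation.Unary.Linked.Properties using (Linked⇒AllPairs; AllPairs⇒Linked)
open import Data.List.Relation.Unary.Unique.Propositional using (Unique)
import Data.List.Relation.Unary.Unique.Propositional.Properties as Unique
open import Data.Nat using (ℕ; suc; _+_; _*_; _≤_; _<_; _≥_; _≟_; s≤s)
open import Data.Nat.ListAction using (sum)
open import Data.Nat.ListAction.Properties using (sum-++)
open import Data.Nat.Properties
  using (≤-refl; ≤-trans; ≤-antisym; ≤-reflexive; <⇒≤; <⇒≢; m≤m+n; m≤n+m; m<m+n;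
         +-comm; +-identityʳ; +-cancelˡ-≡; +-monoˡ-≤; n≮n)
open import Data.Nat.Tactic.RingSolver using (solve-∀)
open import Data.Product using (_×_; _,_; proj₁; proj₂; ∃; ∃₂)
open import Data.Sum using (inj₁; inj₂)
open import Function using (_∘_; mk⇔; Equivalence)
open import Relation.Binary.PropositionalEquality
  using (_≡_; refl; sym; trans; cong; cong₂; subst; module ≡-Reasoning)
open import Relation.Nullary using (contradiction)

-- Counting by mutually inverse maps, and lists seen from the end.

module _ {a b} {A : Set a} {B : Set b} where

  -- Mapping `g` over `map f xs` restores `xs`, and a repetition in `map f xs` would survive this.
  map-unique : ∀ (f : A → B) (g : B → A) {xs} → All (λ x → g (f x) ≡ x) xs →
               Unique xs → Unique (map f xs)
  map-unique f g {xs} gf xs! =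
    Unique.map⁻ (subst Unique (trans (sym (map-id-local gf)) (map-∘ {g = g} {f = f} xs)) xs!)

  -- `map f xs` and `ys` are free of repetitions and have the same members, so they are permutations
  -- of each other. The inverse laws are asked on members only, because the maps used below take
  -- default values elsewhere.
  length-≡ : ∀ {xs ys} (f : A → B) (g : B → A) → Unique xs → Unique ys →
             (∀ {x} → x ∈ xs → f x ∈ ys × g (f x) ≡ x) →
             (∀ {y} → y ∈ ys → g y ∈ xs × f (g y) ≡ y) →
             length xs ≡ length ys
  length-≡ {xs} {ys} f g xs! ys! to from =
    trans (sym (length-map f xs))
          (↭-length (∼bag⇒↭ (unique∧set⇒bag map! ys! (mk⇔ forth back))))
    where
    map! : Unique (map f xs)
    map! = map-unique f g (All.tabulate (proj₂ ∘ to)) xs!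

    forth : ∀ {y} → y ∈ map f xs → y ∈ ys
    forth i with x , j , refl ← ∈-map⁻ f i = proj₁ (to j)

    back : ∀ {y} → y ∈ ys → y ∈ map f xs
    back i with j , eq ← from i = subst (_∈ map f xs) eq (∈-map⁺ f j)

module _ {a} {A : Set a} where

  -- Rewriting with this lets functions that match on `initLast` compute at a list given by its last
  -- entry.
  initLast-∷ʳ : ∀ (xs : List A) x → initLast (xs ∷ʳ x) ≡ xs ∷ʳ′ x
  initLast-∷ʳ []       x = refl
  initLast-∷ʳ (y ∷ xs) x rewrite initLast-∷ʳ xs x = refl

  allPairs-∷ʳ⁻ : ∀ {r} {R : A → A → Set r} xs {y} → AllPairs R (xs ∷ʳ y) →
                 AllPairs R xs × All (λ x → R x y) xs
  allPairs-∷ʳ⁻ []       _        = [] , []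
  allPairs-∷ʳ⁻ (x ∷ xs) (p ∷ ps) =
    let q , r = allPairs-∷ʳ⁻ xs ps; p′ , pʸ = All.∷ʳ⁻ p in p′ ∷ q , pʸ ∷ r

  allPairs-∷ʳ⁺ : ∀ {r} {R : A → A → Set r} {xs y} → AllPairs R xs →
                 All (λ x → R x y) xs → AllPairs R (xs ∷ʳ y)
  allPairs-∷ʳ⁺ ps qs = AllPairs.++⁺ ps ([] ∷ []) (All.map (_∷ []) qs)

-- Extrema and occurrences in lists of numbers.

∈⇒≤sum : ∀ {k ks} → k ∈ ks → k ≤ sum ks
∈⇒≤sum (here refl)            = m≤m+n _ _
∈⇒≤sum {ks = j ∷ _} (there i) = ≤-trans (∈⇒≤sum i) (m≤n+m _ j)

min-unique : ∀ {m k ks} → m ∈ k ∷ ks → All (m ≤_) (k ∷ ks) → min k ks ≡ m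
min-unique {m} {k} {ks} i (p ∷ ps) = ≤-antisym (upper i) (v≤min⁺ p ps)
  where
  upper : m ∈ k ∷ ks → min k ks ≤ m
  upper (here refl) = min≤v⁺ k ks (inj₁ ≤-refl)
  upper (there j)   = min≤v⁺ k ks (inj₂ (lose j ≤-refl))

max-head : ∀ {k ks} → All (_≤ k) ks → max k ks ≡ k
max-head {k} {ks} ps = ≤-antisym (max≤v⁺ ≤-refl ps) (⊥≤max k ks)

∈⇒0<occurrences : ∀ {k ks} → k ∈ ks → 0 < occurrences k ks
∈⇒0<occurrences {k} i = ∈-length (∈-filter⁺ (_≟ k) i refl)

0<occurrences⇒∈ : ∀ k ks → 0 < occurrences k ks → k ∈ ks
0<occurrences⇒∈ k ks p with filter (_≟ k) ks in eq
... | j ∷ _ with i , refl ← ∈-filter⁻ (_≟ k) {xs = ks} (subst (j ∈_) (sym eq) (here refl)) = i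

occurrences-∷ʳ : ∀ k ks → occurrences k (ks ∷ʳ k) ≡ suc (occurrences k ks)
occurrences-∷ʳ k ks = begin
  length (filter (_≟ k) (ks ∷ʳ k))                      ≡⟨ cong length (filter-++ (_≟ k) ks [ k ]) ⟩
  length (filter (_≟ k) ks ++ filter (_≟ k) [ k ])      ≡⟨ length-++ (filter (_≟ k) ks) ⟩
  occurrences k ks + occurrences k [ k ]                ≡⟨ cong (occurrences k ks +_) (once k) ⟩
  occurrences k ks + 1                                  ≡⟨ +-comm _ 1 ⟩
  suc (occurrences k ks)                                ∎
  where
  open ≡-Reasoning
  -- `k ≟ k` does not reduce for a variable `k`, so the count is bounded from both sides.
  once : ∀ k → occurrences k [ k ] ≡ 1
  once k = ≤-antisym (length-filter (_≟ k) [ k ]) (∈⇒0<occurrences {k} (here refl))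

-- The final `m` is the minimum and supplies just one of the two occurrences; the other must come
-- from `ks`.
smallestRepeats⁻ : ∀ {m} ks → All (m ≤_) ks → SmallestRepeats (ks ∷ʳ m) → m ∈ ks
smallestRepeats⁻ {m} []       _  r =
  contradiction (≤-trans r (≤-reflexive (occurrences-∷ʳ m []))) (n≮n 1)
smallestRepeats⁻ {m} (k ∷ ks) ps r
  rewrite min-unique {m} {k} {ks ∷ʳ m} (∈-++⁺ʳ (k ∷ ks) (here refl)) (All.∷ʳ⁺ ps ≤-refl)
        | occurrences-∷ʳ m (k ∷ ks)
  with s≤s q ← r = 0<occurrences⇒∈ m (k ∷ ks) q

smallestRepeats⁺ : ∀ {m} ks → All (m ≤_) ks → m ∈ ks → SmallestRepeats (ks ∷ʳ m)
smallestRepeats⁺ {m} (k ∷ ks) ps i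
  rewrite min-unique {m} {k} {ks ∷ʳ m} (∈-++⁺ʳ (k ∷ ks) (here refl)) (All.∷ʳ⁺ ps ≤-refl)
        | occurrences-∷ʳ m (k ∷ ks) = s≤s (∈⇒0<occurrences i)

-- The common core and its two extensions.

sizes-∷ʳ : ∀ xs y → sizes (xs ∷ʳ y) ≡ sizes xs ∷ʳ size y
sizes-∷ʳ xs y = map-++ size xs [ y ]

sum-sizes-∷ʳ : ∀ xs y → sum (sizes (xs ∷ʳ y)) ≡ sum (sizes xs) + size y
sum-sizes-∷ʳ xs y = begin
  sum (sizes (xs ∷ʳ y))          ≡⟨ cong sum (sizes-∷ʳ xs y) ⟩
  sum (sizes xs ∷ʳ size y)       ≡⟨ sum-++ (sizes xs) [ size y ] ⟩
  sum (sizes xs) + (size y + 0)  ≡⟨ cong (sum (sizes xs) +_) (+-identityʳ _) ⟩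
  sum (sizes xs) + size y        ∎
  where open ≡-Reasoning

-- xs ∷ʳ y is what an overpartition of n with smallest part size y repeated and
-- an overpartition of 2n with spread n have in common.
record IsCore (n : ℕ) (xs : List Part) (y : Part) : Set where
  field
    core-total      : sum (sizes (xs ∷ʳ y)) + size y ≡ n
    core-positive   : All (λ x → 1 ≤ size x) (xs ∷ʳ y)
    core-descending : AllPairs (λ x y → size x ≥ size y) (xs ∷ʳ y)
    core-marking    : AllPairs (λ x y → size x ≡ size y → overlined y ≡ false) (xs ∷ʳ y)

  smallest : All (λ x → size y ≤ size x) (xs ∷ʳ y)
  smallest = All.∷ʳ⁺ (proj₂ (allPairs-∷ʳ⁻ xs core-descending)) ≤-refl

-- The added copy is not a first occurrence, so its overlining is forced to be `false`.
repeatLast : List Part → Part → List Part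
repeatLast xs y = xs ∷ʳ y ∷ʳ part (size y) false

-- Over a core the new part exceeds all others, so it is a first occurrence and `b` is free.
addLargest : ℕ → Bool → List Part → Part → List Part
addLargest n b xs y = part (size y + n) b ∷ (xs ∷ʳ y)

descending-parts : ∀ {n xs} → IsOverpartition n xs →
                   AllPairs (λ x y → size x ≥ size y) xs
descending-parts o = Linked⇒AllPairs (λ p q → ≤-trans q p) (decreasing o)

repeatLast⁺ : ∀ {n xs y} → IsCore n xs y →
              IsOverpartition n (repeatLast xs y) × SmallestRepeats (sizes (repeatLast xs y))
repeatLast⁺ {n} {xs} {y} c =
  isOverpartition
    (trans (sum-sizes-∷ʳ (xs ∷ʳ y) y′) core-total)
    (All.∷ʳ⁺ core-positive (All.lookup core-positive y∈))
    (AllPairs⇒Linked (allPairs-∷ʳ⁺ core-descending smallest))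
    (allPairs-∷ʳ⁺ core-marking (All.universal (λ _ _ → refl) _)) ,
  subst SmallestRepeats (sym (sizes-∷ʳ (xs ∷ʳ y) y′))
    (smallestRepeats⁺ _ (All.map⁺ smallest) (∈-map⁺ size y∈))
  where
  open IsCore c
  y′ = part (size y) false
  y∈ : y ∈ xs ∷ʳ y
  y∈ = ∈-++⁺ʳ xs (here refl)

repeatLast⁻ : ∀ {n zs} → IsOverpartition n zs → SmallestRepeats (sizes zs) →
              ∃₂ λ xs y → IsCore n xs y × zs ≡ repeatLast xs y
repeatLast⁻ {n} {zs} o r with initLast zs
... | cs ∷ʳ′ z with smallestRepeats⁻ (sizes cs)
                      (All.map⁺ (proj₂ (allPairs-∷ʳ⁻ cs (descending-parts o))))
                      (subst SmallestRepeats (sizes-∷ʳ cs z) r)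
-- The membership `i` of `size z` in `sizes cs` excludes an empty `cs`.
... | i with initLast cs
...   | xs ∷ʳ′ y = xs , y , core , cong (xs ∷ʳ y ∷ʳ_) z≡
  where
  desc = allPairs-∷ʳ⁻ (xs ∷ʳ y) (descending-parts o)
  mark = allPairs-∷ʳ⁻ (xs ∷ʳ y) (marking o)

  y∈ : y ∈ xs ∷ʳ y
  y∈ = ∈-++⁺ʳ xs (here refl)

  y-smallest : All (λ x → size y ≤ size x) (xs ∷ʳ y)
  y-smallest = All.∷ʳ⁺ (proj₂ (allPairs-∷ʳ⁻ xs (proj₁ desc))) ≤-refl

  size-≡ : size y ≡ size z
  -- `size z` occurs among sizes of which `size y` is the least, and `z` comes after `y` in the
  -- decreasing order.
  size-≡ = ≤-antisym (All.lookup (All.map⁺ y-smallest) i) (All.lookup (proj₂ desc) y∈)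

  z≡ : z ≡ part (size y) false
  z≡ = cong₂ part (sym size-≡) (All.lookup (proj₂ mark) y∈ size-≡)

  core : IsCore n xs y
  core = record
    { core-total      = trans (cong (sum (sizes (xs ∷ʳ y)) +_) size-≡)
                              (trans (sym (sum-sizes-∷ʳ (xs ∷ʳ y) z)) (total o))
    ; core-positive   = proj₁ (All.∷ʳ⁻ (positive o))
    ; core-descending = proj₁ desc
    ; core-marking    = proj₁ mark
    }

[m+n]+s≡n+[s+m] : ∀ n s m → m + n + s ≡ n + (s + m)
[m+n]+s≡n+[s+m] = solve-∀

addLargest⁺ : ∀ {n xs y} b → IsCore n xs y →
              IsOverpartition (2 * n) (addLargest n b xs y) ×
              HasSpread n (sizes (addLargest n b xs y))
addLargest⁺ {n} {xs} {y} b c =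
  isOverpartition
    total′
    (≤-trans y-positive (m≤m+n (size y) n) ∷ core-positive)
    (AllPairs⇒Linked (All.map <⇒≤ below ∷ core-descending))
    -- No later part has the size of the new one, so the marking condition on these pairs is
    -- vacuous.
    (All.map (λ x<l l≡x → contradiction (sym l≡x) (<⇒≢ x<l)) below ∷ core-marking) ,
  (begin
    max l ks      ≡⟨ max-head (All.map⁺ (All.map <⇒≤ below)) ⟩
    size y + n    ≡⟨ cong (_+ n) (min-unique {size y} {l} {ks}
                       (there (∈-map⁺ size (∈-++⁺ʳ xs (here refl))))
                       (m≤m+n (size y) n ∷ All.map⁺ smallest)) ⟨
    min l ks + n  ∎)
  where
  open IsCore c
  open ≡-Reasoning
  l = size y + n
  ks = sizes (xs ∷ʳ y)

  y-positive : 1 ≤ size y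
  y-positive = All.lookup core-positive (∈-++⁺ʳ xs (here refl))

  total′ : l + sum ks ≡ 2 * n
  total′ = begin
    l + sum ks            ≡⟨ [m+n]+s≡n+[s+m] n (sum ks) (size y) ⟩
    n + (sum ks + size y) ≡⟨ cong (n +_) core-total ⟩
    n + n                 ≡⟨ cong (n +_) (+-identityʳ n) ⟨
    2 * n                 ∎

  sum≤n : sum ks ≤ n
  sum≤n = subst (sum ks ≤_) core-total (m≤m+n _ _)

  -- Each part is at most the sum of all, hence at most `n`, while `size y ≥ 1` puts `l` strictly
  -- above `n`.
  below : All (λ x → size x < l) (xs ∷ʳ y)
  below = All.tabulate λ i →
    ≤-trans (s≤s (≤-trans (∈⇒≤sum (∈-map⁺ size i)) sum≤n)) (+-monoˡ-≤ n y-positive)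

-- The first part is the maximum and the last the minimum, so the spread fixes the first size as
-- `size y + n`. Cancelling `n` in the total `2 * n` then leaves the total of the core, with
-- `size y` counted once more.
addLargest⁻ : ∀ {n zs} → 1 ≤ n → IsOverpartition (2 * n) zs → HasSpread n (sizes zs) →
              ∃ λ b → ∃₂ λ xs y → IsCore n xs y × zs ≡ addLargest n b xs y
addLargest⁻ {n} {z ∷ cs} 1≤n o s with initLast cs
-- A single part has spread 0, which `1 ≤ n` excludes.
... | []        = contradiction s (<⇒≢ (m<m+n (size z) 1≤n))
... | xs ∷ʳ′ y with desc@(largest ∷ desc′) ← descending-parts o
                  | _ ∷ pos ← positive o | _ ∷ mark ← marking o =
  overlined z , xs , y , core , cong (λ k → part k (overlined z) ∷ (xs ∷ʳ y)) size-z
  where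
  open ≡-Reasoning
  ks = sizes (xs ∷ʳ y)

  size-z : size z ≡ size y + n
  size-z = begin
    size z              ≡⟨ max-head (All.map⁺ largest) ⟨
    max (size z) ks     ≡⟨ s ⟩
    min (size z) ks + n ≡⟨ cong (_+ n) (min-unique {size y} {size z} {ks}
                             (there (∈-map⁺ size (∈-++⁺ʳ xs (here refl))))
                             (All.map⁺ (All.∷ʳ⁺ (proj₂ (allPairs-∷ʳ⁻ (z ∷ xs) desc)) ≤-refl))) ⟩
    size y + n          ∎

  core : IsCore n xs y
  core = record
    { core-total      = +-cancelˡ-≡ n _ _ (begin
        n + (sum ks + size y) ≡⟨ [m+n]+s≡n+[s+m] n (sum ks) (size y) ⟨
        size y + n + sum ks   ≡⟨ cong (_+ sum ks) size-z ⟨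
        size z + sum ks       ≡⟨ total o ⟩
        2 * n                 ≡⟨ cong (n +_) (+-identityʳ n) ⟩
        n + n                 ∎)
    ; core-positive   = pos
    ; core-descending = desc′
    ; core-marking    = mark
    }

-- The bijection as a pair of total functions.

lastToFront : ℕ → Bool × List Part → List Part
lastToFront n (b , zs) with initLast zs
... | []       = []
... | cs ∷ʳ′ z = part (size z + n) b ∷ cs

-- Of the first part only the overlining is kept: its size is determined by `n` and the last part.
-- Lists with fewer than two parts get a default value; none of them has spread `n ≥ 1`.
frontToLast : List Part → Bool × List Part
frontToLast []       = false , []
frontToLast (z ∷ cs) with initLast cs
... | []       = false , []
... | xs ∷ʳ′ y = overlined z , repeatLast xs y

lastToFront-repeatLast : ∀ n b xs y → lastToFront n (b , repeatLast xs y) ≡ addLargest n b xs y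
lastToFront-repeatLast n b xs y rewrite initLast-∷ʳ (xs ∷ʳ y) (part (size y) false) = refl

frontToLast-addLargest : ∀ n b xs y → frontToLast (addLargest n b xs y) ≡ (b , repeatLast xs y)
frontToLast-addLargest n b xs y rewrite initLast-∷ʳ xs y = refl

-- The factor 2 as a choice of overlining, and the count.

bools : List Bool
bools = false ∷ true ∷ []

bools-unique : Unique bools
bools-unique = ((λ ()) ∷ []) ∷ [] ∷ []

∈-bools : ∀ b → b ∈ bools
∈-bools false = here refl
∈-bools true  = there (here refl)

length-cartesianProduct : ∀ {a b} {A : Set a} {B : Set b} (xs : List A) (ys : List B) →
                          length (cartesianProduct xs ys) ≡ length xs * length ys
length-cartesianProduct []       ys = refl
length-cartesianProduct {B = B} (x ∷ xs) ys = begin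
  length (map pair ys ++ cartesianProduct xs ys)
    ≡⟨ length-++ (map pair ys) ⟩
  length (map pair ys) + length (cartesianProduct xs ys)
    ≡⟨ cong₂ _+_ (length-map pair ys) (length-cartesianProduct xs ys) ⟩
  length ys + length xs * length ys ∎
  where
  open ≡-Reasoning
  pair : B → _ × B
  pair = x ,_

theorem5p2 : ∀ (n : ℕ) → 1 ≤ n → 2 * a̅₂ n ≡ p̅ (2 * n) n
theorem5p2 n 1≤n =
  -- `length bools` computes to 2, so the left side counts pairs of an overlining for the new
  -- largest part and an overpartition with repeated smallest part.
  trans (sym (length-cartesianProduct bools repeating))
        (length-≡ (lastToFront n) frontToLast
          (Unique.cartesianProduct⁺ bools-unique
            (Unique.filter⁺ (smallestRepeats? ∘ sizes) (overpartitions-unique n)))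
          (Unique.filter⁺ (hasSpread? n ∘ sizes) (overpartitions-unique (2 * n)))
          to from)
  where
  repeating = filter (smallestRepeats? ∘ sizes) (overpartitions n)
  spread    = filter (hasSpread? n ∘ sizes) (overpartitions (2 * n))

  to : ∀ {p} → p ∈ cartesianProduct bools repeating →
       lastToFront n p ∈ spread × frontToLast (lastToFront n p) ≡ p
  to {b , zs} i
    with j , r ← ∈-filter⁻ (smallestRepeats? ∘ sizes) {xs = overpartitions n}
                   (proj₂ (∈-cartesianProduct⁻ bools repeating i))
    -- Once `zs` is expressed through its core, both maps are known on it, which gives the
    -- membership and the inverse law together; `from` proceeds likewise.
    with xs , y , c , refl ← repeatLast⁻ (Equivalence.to ∈-overpartitions j) r
    rewrite lastToFront-repeatLast n b xs y =
    let o , s = addLargest⁺ b c in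
    ∈-filter⁺ (hasSpread? n ∘ sizes) (Equivalence.from ∈-overpartitions o) s ,
    frontToLast-addLargest n b xs y

  from : ∀ {zs} → zs ∈ spread →
         frontToLast zs ∈ cartesianProduct bools repeating ×
         lastToFront n (frontToLast zs) ≡ zs
  from i
    with j , s ← ∈-filter⁻ (hasSpread? n ∘ sizes) {xs = overpartitions (2 * n)} i
    with b , xs , y , c , refl ← addLargest⁻ 1≤n (Equivalence.to ∈-overpartitions j) s
    rewrite frontToLast-addLargest n b xs y =
    let o , r = repeatLast⁺ c in
    ∈-cartesianProduct⁺ (∈-bools b)
      (∈-filter⁺ (smallestRepeats? ∘ sizes) (Equivalence.from ∈-overpartitions o) r) ,
    lastToFront-repeatLast n b xs y
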